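{- Let $k\ge 1$ and let $n_1,\ldots,n_k$ be positive integers. Then the domination polynomial of the complete multipartite graph $K_{n_1,\ldots,n_k}$ is unimodal.
   Context: $K_{n_1,\ldots,n_k}$ is the graph whose vertex set is partitioned into parts of sizes $n_1,\ldots,n_k$, two vertices being adjacent if and only if they lie in different parts. A subset $S$ of the vertices of a graph $G$ is a dominating set if every vertex of $G$ is either in $S$ or adjacent to a vertex of $S$. Let $d_i(G)$ be the number of dominating sets of $G$ of cardinality $i$. The domination polynomial of $G$ is $D(G,x)=\sum_{i} d_i(G)x^i$, where $0\le i\le |V(G)|$ (coefficients below the domination number are $0$). A real polynomial $a_0+a_1x+\cdots+a_nx^n$ is unimodal if there is $0\le k\le n$ with $a_0\le a_1\le\cdots\le a_k\ge a_{k+1}\ge\cdots\ge a_n$. -}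

module Defs where

open import Data.Fin.Base using (Fin; zero; suc; toℕ; inject₁; splitAt)
open import Data.Fin.Properties using (all?; any?) renaming (_≟_ to _≟ᶠ_)
open import Data.Fin.Subset using (Subset; inside; outside; _∈_; ∣_∣)
open import Data.Fin.Subset.Properties using (_∈?_)
open import Data.List.Base as List using (List; _++_; length; filter)
open import Data.Nat.Base using (ℕ; zero; suc; _≤_; _≥_; _<_)
open import Data.Nat.Properties using (_≟_)
open import Data.Product.Base using (_×_; ∃)
open import Data.Sum.Base using (_⊎_; [_,_]′)
open import Data.Vec.Base using (Vec; []; _∷_; sum)
open import Data.Vec.Functional using (Vector)
open import Function.Base using (const; _∘_)
open import Level using (0ℓ)
open import Relation.Binary.Core using (Rel)
open import Relation.Binary.Definitions using (Symmetric; Irreflexive; Decidable)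
open import Relation.Binary.PropositionalEquality using (_≡_; _≢_; cong; ≢-sym)
open import Relation.Nullary.Decidable using (Dec; ¬?; _×-dec_; _⊎-dec_)

-- Finite simple graphs on the vertex set Fin order.  Adjacency is required to
-- be decidable so that dominating sets can be counted.
record Graph : Set₁ where
  field
    order    : ℕ
    Adj      : Rel (Fin order) 0ℓ
    adj?     : Decidable Adj
    symm     : Symmetric Adj
    loopless : Irreflexive _≡_ Adj

open Graph public using (order)

-- The vertices of K_{n₁,…,n_k} are numbered part by part: the first n₁ form
-- part 0, the next n₂ form part 1, and so on.
part : ∀ {k} (ns : Vec ℕ k) → Fin (sum ns) → Fin k
part (n ∷ ns) v = [ const zero , suc ∘ part ns ]′ (splitAt n v)

completeMultipartite : ∀ {k} → Vec ℕ k → Graph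
completeMultipartite ns = record
  { order    = sum ns
  ; Adj      = λ u v → part ns u ≢ part ns v
  ; adj?     = λ u v → ¬? (part ns u ≟ᶠ part ns v)
  ; symm     = ≢-sym
  ; loopless = λ u≡v differ → differ (cong (part ns) u≡v)
  }

module _ (G : Graph) where
  open Graph G using (Adj; adj?)

  Dominating : Subset (order G) → Set
  Dominating S = ∀ v → v ∈ S ⊎ ∃ λ u → u ∈ S × Adj v u

  dominating? : ∀ S → Dec (Dominating S)
  dominating? S =
    all? λ v → (v ∈? S) ⊎-dec any? λ u → (u ∈? S) ×-dec adj? v u

-- Every subset of Fin n, listed exactly once.
subsets : ∀ n → List (Subset n)
subsets zero    = List.[ [] ]
subsets (suc n) = List.map (outside ∷_) (subsets n) ++ List.map (inside ∷_) (subsets n)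

dominatingSets : (G : Graph) → ℕ → List (Subset (order G))
dominatingSets G i =
  filter (λ S → dominating? G S ×-dec (∣ S ∣ ≟ i)) (subsets (order G))

-- A polynomial a₀ + a₁x + ⋯ + aₙxⁿ is given by its coefficients a₀, …, aₙ.
-- Natural number coefficients suffice, since those of a domination polynomial
-- are cardinalities.
Polynomial : ℕ → Set
Polynomial n = Vector ℕ (suc n)

dominationPolynomial : (G : Graph) → Polynomial (order G)
dominationPolynomial G i = length (dominatingSets G (toℕ i))

-- For i : Fin n, the elements inject₁ i and suc i of Fin (suc n) are the
-- consecutive indices i and i + 1.
Unimodal : ∀ {n} → Polynomial n → Set
Unimodal {n} a = ∃ λ (k : Fin (suc n)) →
    (∀ (i : Fin n) → toℕ i < toℕ k → a (inject₁ i) ≤ a (suc i))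
  × (∀ (i : Fin n) → toℕ k ≤ toℕ i → a (inject₁ i) ≥ a (suc i))

{-# OPTIONS --safe #-}
-- Dominating sets are upward closed, so dᵢ ≤ dᵢ₊₁ for 2i < n.  Let 2i ≥ n.  If all
-- parts have at most i vertices, every i-set dominates and dᵢ = C(n, i).  Otherwise
-- a unique part has m > i vertices, the non-dominating i-sets are its subsets, and
-- dᵢ = C(n, i) − C(m, i).  Comparing these values shows that the coefficients decrease
-- from ⌈n/2⌉ on.  The two exceptions are the edgeless graph (m = n) and K₃,₁: there
-- the large part, itself a dominating set, moves the mode to n and to 3, respectively.
module Submission where

open import Defs
open import Data.Bool.Base using (true; false; if_then_else_)
open import Data.Empty using (⊥)
open import Data.Fin.Base using (Fin; toℕ; inject₁; fromℕ<)
open import Data.Fin.Properties using (any?; toℕ<n; toℕ-inject₁; toℕ-fromℕ<)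
  renaming (_≟_ to _≟ᶠ_)
open import Data.Fin.Subset using (Subset; inside; outside; _∈_; _∉_; _⊆_; ∁; ∣_∣)
open import Data.Fin.Subset.Properties
  using (_∈?_; _⊆?_; out⊆; s⊆s; ⊆-refl; drop-∷-⊆; ∣p∣≤n; ∣∁p∣≡n∸∣p∣;
         p⊆q⇒∣p∣≤∣q∣; p⊂q⇒∣p∣<∣q∣; x∉p⇒x∈∁p)
open import Data.List.Base as List using (List; length; filter)
open import Data.List.Properties using (filter-++; filter-≐; filter-none; length-++)
import Data.List.Relation.Unary.All as ListAll
open import Data.Nat.Base
open import Data.Nat.Combinatorics
  using (_C_; nC1≡n; nCn≡1; nCk≡nC[n∸k]; k>n⇒nCk≡0; nCk+nC[k+1]≡[n+1]C[k+1])
open import Data.Nat.Properties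
open import Data.Nat.Tactic.RingSolver using (solve-∀)
open import Data.Product.Base using (_×_; _,_; ∃)
open import Data.Sum.Base as Sum using (_⊎_; inj₁; inj₂; [_,_]′)
open import Data.Vec.Base using (Vec; []; _∷_; here; sum; tabulate)
open import Data.Vec.Properties using ([]=⇒lookup; lookup⇒[]=; lookup∘tabulate)
open import Data.Vec.Relation.Unary.All using (All)
open import Function.Base using (_∘_; case_of_)
open import Level using (0ℓ)
open import Relation.Binary.PropositionalEquality
open import Relation.Nullary using (¬_; yes; no; does; contradiction; ¬?; _×-dec_)
open import Relation.Nullary.Decidable using (dec-true; decidable-stable)
open import Relation.Unary using (Pred; Decidable)
open import Relation.Unary.Properties using (U?)

-- Binomial coefficients near the ends of a row.

nC0≡1 : ∀ n → n C 0 ≡ 1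
nC0≡1 n = trans (nCk≡nC[n∸k] {0} {n} z≤n) (nCn≡1 n)

[1+n]Cn≡1+n : ∀ n → suc n C n ≡ suc n
[1+n]Cn≡1+n n = begin
  suc n C n            ≡⟨ nCk≡nC[n∸k] (n≤1+n n) ⟩
  suc n C (suc n ∸ n)  ≡⟨ cong (suc n C_) (m+n∸n≡m 1 n) ⟩
  suc n C 1            ≡⟨ nC1≡n (suc n) ⟩
  suc n                ∎
  where open ≡-Reasoning

-- Counting subsets of a given size by recursion.

length-filter-map : {A B : Set} {P : Pred B 0ℓ} (P? : Decidable P) (f : A → B) (xs : List A) →
  length (filter P? (List.map f xs)) ≡ length (filter (P? ∘ f) xs)
length-filter-map P? f List.[] = refl
length-filter-map P? f (x List.∷ xs) with does (P? (f x))
... | true  = cong suc (length-filter-map P? f xs)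
... | false = length-filter-map P? f xs

-- Splitting on whether the first element is chosen mirrors Pascal's rule, so comparisons of `count`
-- with binomial coefficients become inductions along Pascal's triangle.
count : ∀ {n} {P : Pred (Subset n) 0ℓ} → Decidable P → ℕ → ℕ
count {zero}  P? zero    = if does (P? []) then 1 else 0
count {zero}  P? (suc i) = 0
count {suc n} P? zero    = count (P? ∘ (outside ∷_)) zero
count {suc n} P? (suc i) = count (P? ∘ (outside ∷_)) (suc i) + count (P? ∘ (inside ∷_)) i

ofSize? : ∀ {n} {P : Pred (Subset n) 0ℓ} → Decidable P → ∀ i → Decidable (λ S → P S × ∣ S ∣ ≡ i)
ofSize? P? i S = P? S ×-dec (∣ S ∣ ≟ i)

-- The bridge from the list-based coefficients of `dominationPolynomial` to `count`, in terms of
-- which all later estimates are made.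
length-filter-subsets : ∀ {n} {P : Pred (Subset n) 0ℓ} (P? : Decidable P) i →
  length (filter (ofSize? P? i) (subsets n)) ≡ count P? i
length-filter-subsets {zero} P? zero with P? []
... | yes _ = refl
... | no  _ = refl
length-filter-subsets {zero} P? (suc i) with P? []
... | yes _ = refl
... | no  _ = refl
length-filter-subsets {suc n} P? i = begin
  length (filter (ofSize? P? i) (outs List.++ ins))
    ≡⟨ cong length (filter-++ (ofSize? P? i) outs ins) ⟩
  length (filter (ofSize? P? i) outs List.++ filter (ofSize? P? i) ins)
    ≡⟨ length-++ (filter (ofSize? P? i) outs) ⟩
  length (filter (ofSize? P? i) outs) + length (filter (ofSize? P? i) ins)
    ≡⟨ cong₂ _+_ (trans (length-filter-map (ofSize? P? i) (outside ∷_) (subsets n))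
                        (length-filter-subsets (P? ∘ (outside ∷_)) i))
                 (length-filter-map (ofSize? P? i) (inside ∷_) (subsets n)) ⟩
  count (P? ∘ (outside ∷_)) i + length (filter (ofSize? P? i ∘ (inside ∷_)) (subsets n))
    ≡⟨ split i ⟩
  count P? i ∎
  where
  open ≡-Reasoning
  outs = List.map (outside ∷_) (subsets n)
  ins  = List.map (inside ∷_) (subsets n)
  split : ∀ i → count (P? ∘ (outside ∷_)) i
                  + length (filter (ofSize? P? i ∘ (inside ∷_)) (subsets n)) ≡ count P? i
  -- A set containing the first element is not empty, so the second summand vanishes.
  split zero = trans
    (cong (λ xs → count (P? ∘ (outside ∷_)) 0 + length xs)
      (filter-none (ofSize? P? 0 ∘ (inside ∷_)) (ListAll.universal (λ _ ()) (subsets n))))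
    (+-identityʳ _)
  split (suc i) = cong (count (P? ∘ (outside ∷_)) (suc i) +_) (trans
    (cong length (filter-≐ (ofSize? P? (suc i) ∘ (inside ∷_)) (ofSize? (P? ∘ (inside ∷_)) i)
      ((λ (p , eq) → p , suc-injective eq) , λ (p , eq) → p , cong suc eq) (subsets n)))
    (length-filter-subsets (P? ∘ (inside ∷_)) i))

count-none : ∀ {n} {P : Pred (Subset n) 0ℓ} (P? : Decidable P) i → (∀ S → ¬ P S) → count P? i ≡ 0
count-none {zero}  P? zero    ¬P with P? []
... | yes p = contradiction p (¬P [])
... | no  _ = refl
count-none {zero}  P? (suc i) ¬P = refl
count-none {suc n} P? zero    ¬P = count-none (P? ∘ (outside ∷_)) zero (¬P ∘ (outside ∷_))
count-none {suc n} P? (suc i) ¬P =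
  cong₂ _+_ (count-none (P? ∘ (outside ∷_)) (suc i) (¬P ∘ (outside ∷_)))
            (count-none (P? ∘ (inside ∷_)) i (¬P ∘ (inside ∷_)))

count-mono : ∀ {n} {P Q : Pred (Subset n) 0ℓ} (P? : Decidable P) (Q? : Decidable Q) i →
  (∀ S → P S → Q S) → count P? i ≤ count Q? i
count-mono {zero} P? Q? zero P⇒Q with P? [] | Q? []
... | yes p | no ¬q = contradiction (P⇒Q [] p) ¬q
... | yes _ | yes _ = ≤-refl
... | no  _ | _     = z≤n
count-mono {zero}  P? Q? (suc i) P⇒Q = z≤n
count-mono {suc n} P? Q? zero    P⇒Q =
  count-mono (P? ∘ (outside ∷_)) (Q? ∘ (outside ∷_)) zero (P⇒Q ∘ (outside ∷_))
count-mono {suc n} P? Q? (suc i) P⇒Q =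
  +-mono-≤ (count-mono (P? ∘ (outside ∷_)) (Q? ∘ (outside ∷_)) (suc i) (P⇒Q ∘ (outside ∷_)))
           (count-mono (P? ∘ (inside ∷_)) (Q? ∘ (inside ∷_)) i (P⇒Q ∘ (inside ∷_)))

count-cong : ∀ {n} {P Q : Pred (Subset n) 0ℓ} (P? : Decidable P) (Q? : Decidable Q) i →
  (∀ S → P S → Q S) → (∀ S → Q S → P S) → count P? i ≡ count Q? i
count-cong P? Q? i P⇒Q Q⇒P = ≤-antisym (count-mono P? Q? i P⇒Q) (count-mono Q? P? i Q⇒P)

-- If the first element is not in `M`, only the sets avoiding it contribute; if it is in `M`, both
-- kinds do, and Pascal's rule adds them up.
count-⊆ : ∀ {n} (M : Subset n) i → count (_⊆? M) i ≡ ∣ M ∣ C i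
count-⊆ []            zero    = refl
count-⊆ []            (suc i) = sym (k>n⇒nCk≡0 {0} {suc i} z<s)
count-⊆ (outside ∷ M) zero    =
  trans (count-cong ((_⊆? (outside ∷ M)) ∘ (outside ∷_)) (_⊆? M) 0 (λ _ → drop-∷-⊆) (λ _ → s⊆s))
        (count-⊆ M 0)
count-⊆ (outside ∷ M) (suc i) = trans (cong₂ _+_
    (trans (count-cong ((_⊆? (outside ∷ M)) ∘ (outside ∷_)) (_⊆? M) (suc i)
             (λ _ → drop-∷-⊆) (λ _ → s⊆s))
           (count-⊆ M (suc i)))
    (count-none ((_⊆? (outside ∷ M)) ∘ (inside ∷_)) i
      (λ _ in⊆out → case in⊆out here of λ ())))
  (+-identityʳ _)
count-⊆ (inside ∷ M) zero = trans
  (count-cong ((_⊆? (inside ∷ M)) ∘ (outside ∷_)) (_⊆? M) 0 (λ _ → drop-∷-⊆) (λ _ → out⊆))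
  (trans (count-⊆ M 0) (trans (nC0≡1 ∣ M ∣) (sym (nC0≡1 (suc ∣ M ∣)))))
count-⊆ (inside ∷ M) (suc i) = begin
  count ((_⊆? (inside ∷ M)) ∘ (outside ∷_)) (suc i) + count ((_⊆? (inside ∷ M)) ∘ (inside ∷_)) i
    ≡⟨ cong₂ _+_
         (count-cong ((_⊆? (inside ∷ M)) ∘ (outside ∷_)) (_⊆? M) (suc i) (λ _ → drop-∷-⊆) (λ _ → out⊆))
         (count-cong ((_⊆? (inside ∷ M)) ∘ (inside ∷_)) (_⊆? M) i (λ _ → drop-∷-⊆) (λ _ → s⊆s)) ⟩
  count (_⊆? M) (suc i) + count (_⊆? M) i
    ≡⟨ cong₂ _+_ (count-⊆ M (suc i)) (count-⊆ M i) ⟩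
  ∣ M ∣ C suc i + ∣ M ∣ C i
    ≡⟨ +-comm (∣ M ∣ C suc i) (∣ M ∣ C i) ⟩
  ∣ M ∣ C i + ∣ M ∣ C suc i
    ≡⟨ nCk+nC[k+1]≡[n+1]C[k+1] ∣ M ∣ i ⟩
  suc ∣ M ∣ C suc i ∎
  where open ≡-Reasoning

-- Disjoint and covering families compared with binomial coefficients.

+-rotate : ∀ a b c → (a + b) + c ≡ (b + c) + a
+-rotate = solve-∀

+-swapʳ : ∀ a b c → (a + b) + c ≡ (a + c) + b
+-swapʳ = solve-∀

+-swap-interchange : ∀ a b c d → (a + c) + (b + d) ≡ (c + d) + (a + b)
+-swap-interchange = solve-∀

-- Disjointness is asked only among sets of size `i`, because whether a subset of a part fails to
-- dominate depends on its size. The induction is Pascal's rule.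
count-disjoint : ∀ {n} {P Q : Pred (Subset n) 0ℓ} (P? : Decidable P) (Q? : Decidable Q) i →
  (∀ S → ∣ S ∣ ≡ i → P S → ¬ Q S) → count P? i + count Q? i ≤ n C i
count-disjoint {zero} P? Q? zero dis with P? [] | Q? []
... | yes p | yes q = contradiction q (dis [] refl p)
... | yes _ | no  _ = ≤-refl
... | no  _ | yes _ = ≤-refl
... | no  _ | no  _ = z≤n
count-disjoint {zero}  P? Q? (suc i) dis = z≤n
count-disjoint {suc n} P? Q? zero    dis = begin
  count (P? ∘ (outside ∷_)) 0 + count (Q? ∘ (outside ∷_)) 0
    ≤⟨ count-disjoint (P? ∘ (outside ∷_)) (Q? ∘ (outside ∷_)) 0 (dis ∘ (outside ∷_)) ⟩
  n C 0      ≡⟨ trans (nC0≡1 n) (sym (nC0≡1 (suc n))) ⟩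
  suc n C 0  ∎
  where open ≤-Reasoning
count-disjoint {suc n} P? Q? (suc i) dis = begin
  count P? (suc i) + count Q? (suc i)
    ≡⟨ +-swap-interchange p q (count (P? ∘ (inside ∷_)) i) (count (Q? ∘ (inside ∷_)) i) ⟩
  (count (P? ∘ (inside ∷_)) i + count (Q? ∘ (inside ∷_)) i) + (p + q)
    ≤⟨ +-mono-≤
         (count-disjoint (P? ∘ (inside ∷_)) (Q? ∘ (inside ∷_)) i
           (λ S eq → dis (inside ∷ S) (cong suc eq)))
         (count-disjoint (P? ∘ (outside ∷_)) (Q? ∘ (outside ∷_)) (suc i) (dis ∘ (outside ∷_))) ⟩
  n C i + n C suc i  ≡⟨ nCk+nC[k+1]≡[n+1]C[k+1] n i ⟩
  suc n C suc i      ∎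
  where
  open ≤-Reasoning
  p = count (P? ∘ (outside ∷_)) (suc i)
  q = count (Q? ∘ (outside ∷_)) (suc i)

-- The counterpart of `count-disjoint`: together they turn a partition of the `i`-sets into an exact
-- count.
count-cover : ∀ {n} {P Q : Pred (Subset n) 0ℓ} (P? : Decidable P) (Q? : Decidable Q) i →
  (∀ S → ∣ S ∣ ≡ i → P S ⊎ Q S) → n C i ≤ count P? i + count Q? i
count-cover {zero} P? Q? zero cov with P? [] | Q? []
... | yes _ | _     = s≤s z≤n
... | no  _ | yes _ = ≤-refl
... | no ¬p | no ¬q = contradiction (cov [] refl) [ ¬p , ¬q ]′
count-cover {zero}  P? Q? (suc i) cov = ≤-reflexive (k>n⇒nCk≡0 {0} {suc i} z<s)
count-cover {suc n} P? Q? zero    cov = begin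
  suc n C 0  ≡⟨ trans (nC0≡1 (suc n)) (sym (nC0≡1 n)) ⟩
  n C 0
    ≤⟨ count-cover (P? ∘ (outside ∷_)) (Q? ∘ (outside ∷_)) 0 (cov ∘ (outside ∷_)) ⟩
  count (P? ∘ (outside ∷_)) 0 + count (Q? ∘ (outside ∷_)) 0 ∎
  where open ≤-Reasoning
count-cover {suc n} P? Q? (suc i) cov = begin
  suc n C suc i      ≡⟨ nCk+nC[k+1]≡[n+1]C[k+1] n i ⟨
  n C i + n C suc i
    ≤⟨ +-mono-≤
         (count-cover (P? ∘ (inside ∷_)) (Q? ∘ (inside ∷_)) i
           (λ S eq → cov (inside ∷ S) (cong suc eq)))
         (count-cover (P? ∘ (outside ∷_)) (Q? ∘ (outside ∷_)) (suc i) (cov ∘ (outside ∷_))) ⟩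
  (count (P? ∘ (inside ∷_)) i + count (Q? ∘ (inside ∷_)) i) + (p + q)
    ≡⟨ +-swap-interchange p q (count (P? ∘ (inside ∷_)) i) (count (Q? ∘ (inside ∷_)) i) ⟨
  count P? (suc i) + count Q? (suc i) ∎
  where
  open ≤-Reasoning
  p = count (P? ∘ (outside ∷_)) (suc i)
  q = count (Q? ∘ (outside ∷_)) (suc i)

-- Taking the second family empty specialises the two preceding bounds to a single family.
∅? : ∀ {n} → Decidable {A = Subset n} (λ _ → ⊥)
∅? _ = no λ ()

count≤C : ∀ {n} {P : Pred (Subset n) 0ℓ} (P? : Decidable P) i → count P? i ≤ n C i
count≤C {n} P? i = m+n≤o⇒m≤o _ (count-disjoint P? (∅? {n}) i (λ _ _ _ ()))

C≤count : ∀ {n} {P : Pred (Subset n) 0ℓ} (P? : Decidable P) i →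
  (∀ S → ∣ S ∣ ≡ i → P S) → n C i ≤ count P? i
C≤count {n} P? i all = begin
  n C i                    ≤⟨ count-cover P? (∅? {n}) i (λ S eq → inj₁ (all S eq)) ⟩
  count P? i + count (∅? {n}) i  ≡⟨ cong (count P? i +_) (count-none {n} ∅? i (λ _ ())) ⟩
  count P? i + 0           ≡⟨ +-identityʳ (count P? i) ⟩
  count P? i               ∎
  where open ≤-Reasoning

-- Upward closed families grow in the lower half.

UpwardClosed : ∀ {n} → Pred (Subset n) 0ℓ → Set
UpwardClosed P = ∀ {S T} → S ⊆ T → P S → P T

-- Double counting of the pairs S ⊂ S ∪ {v} gives (n − i) dᵢ ≤ (i + 1) dᵢ₊₁ for
-- an upward closed family; the summand i dᵢ is moved to avoid subtraction.
n*count≤ : ∀ {n} {P : Pred (Subset n) 0ℓ} (P? : Decidable P) → UpwardClosed P → ∀ i →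
  n * count P? i ≤ i * count P? i + suc i * count P? (suc i)
n*count≤ {zero}  P? up i    = z≤n
n*count≤ {suc n} P? up zero = begin
  x + n * x            ≤⟨ +-mono-≤ (count-mono (P? ∘ (outside ∷_)) (P? ∘ (inside ∷_)) 0
                                     (λ _ → up (out⊆ ⊆-refl)))
                                   (n*count≤ (P? ∘ (outside ∷_)) (up ∘ s⊆s) 0) ⟩
  w + (z + 0)          ≡⟨ rearrange z w ⟩
  (z + w) + 0          ∎
  where
  open ≤-Reasoning
  x = count (P? ∘ (outside ∷_)) 0
  z = count (P? ∘ (outside ∷_)) 1
  w = count (P? ∘ (inside ∷_)) 0
  rearrange : ∀ z w → w + (z + 0) ≡ (z + w) + 0
  rearrange = solve-∀
n*count≤ {suc n} P? up (suc j) = begin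
  suc n * (x + y)
    ≡⟨ expand n x y ⟩
  x + (n * x + n * y) + y
    ≤⟨ +-monoˡ-≤ y (+-mono-≤ x≤w
         (+-mono-≤ (n*count≤ (P? ∘ (outside ∷_)) (up ∘ s⊆s) (suc j))
                   (n*count≤ (P? ∘ (inside ∷_)) (up ∘ s⊆s) j))) ⟩
  w + (suc j * x + suc (suc j) * z + (j * y + suc j * w)) + y
    ≡⟨ collect j x y z w ⟩
  suc j * (x + y) + suc (suc j) * (z + w) ∎
  where
  open ≤-Reasoning
  x = count (P? ∘ (outside ∷_)) (suc j)
  y = count (P? ∘ (inside ∷_)) j
  z = count (P? ∘ (outside ∷_)) (suc (suc j))
  w = count (P? ∘ (inside ∷_)) (suc j)
  -- These are the pairs in which the added element is the first one; the two induction hypotheses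
  -- account for all other pairs.
  x≤w : x ≤ w
  x≤w = count-mono (P? ∘ (outside ∷_)) (P? ∘ (inside ∷_)) (suc j) (λ _ → up (out⊆ ⊆-refl))
  expand : ∀ n x y → suc n * (x + y) ≡ x + (n * x + n * y) + y
  expand = solve-∀
  collect : ∀ j x y z w → w + (suc j * x + suc (suc j) * z + (j * y + suc j * w)) + y
                            ≡ suc j * (x + y) + suc (suc j) * (z + w)
  collect = solve-∀

-- Since `2i + 1 ≤ n`, the left side of `n*count≤` is at least `i dᵢ + (i + 1) dᵢ`. Cancelling
-- `i dᵢ` and then the factor `i + 1` gives the claim.
count-increasing : ∀ {n} {P : Pred (Subset n) 0ℓ} (P? : Decidable P) → UpwardClosed P →
  ∀ i → i + i < n → count P? i ≤ count P? (suc i)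
count-increasing {n} P? up i i+i<n = *-cancelˡ-≤ (suc i) (+-cancelˡ-≤ (i * a) _ _ (begin
  i * a + suc i * a             ≡⟨ *-distribʳ-+ a i (suc i) ⟨
  (i + suc i) * a               ≤⟨ *-monoˡ-≤ a (≤-trans (≤-reflexive (+-suc i i)) i+i<n) ⟩
  n * a                         ≤⟨ n*count≤ P? up i ⟩
  i * a + suc i * count P? (suc i) ∎))
  where
  open ≤-Reasoning
  a = count P? i

-- Monotonicity of binomial coefficients and of their gaps.

-- The family of all subsets is upward closed, and its counts are the binomial coefficients.
C-increasing : ∀ n i → i + i < n → n C i ≤ n C suc i
C-increasing n i i+i<n = begin
  n C i                     ≤⟨ C≤count U? i _ ⟩
  count {n} U? i            ≤⟨ count-increasing {n} U? _ i i+i<n ⟩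
  count {n} U? (suc i)      ≤⟨ count≤C {n} U? (suc i) ⟩
  n C suc i                 ∎
  where open ≤-Reasoning

-- Writing `n = i + 1 + k`, the symmetry of the row sends `i + 1` and `i` to `k` and `k + 1`. The
-- hypothesis becomes `k ≤ i`, which puts `k` in the increasing half.
C-decreasing : ∀ n i → n ≤ suc (i + i) → n C suc i ≤ n C i
C-decreasing n i n≤1+i+i with suc i ≤? n
... | no  i≮n = ≤-trans (≤-reflexive (k>n⇒nCk≡0 (≰⇒> i≮n))) z≤n
... | yes i<n with k , refl ← m≤n⇒∃[o]m+o≡n i<n = begin
  n C suc i          ≡⟨ nCk≡nC[n∸k] (m≤m+n (suc i) k) ⟩
  n C (n ∸ suc i)    ≡⟨ cong (n C_) (m+n∸m≡n (suc i) k) ⟩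
  n C k              ≤⟨ C-increasing n k (s≤s (+-monoˡ-≤ k k≤i)) ⟩
  n C suc k          ≡⟨ cong (n C_) (m+n∸m≡n i (suc k)) ⟨
  n C (i + suc k ∸ i) ≡⟨ cong (λ m → n C (m ∸ i)) (+-suc i k) ⟩
  n C (n ∸ i)        ≡⟨ nCk≡nC[n∸k] (≤-trans (n≤1+n i) i<n) ⟨
  n C i              ∎
  where
  open ≤-Reasoning
  k≤i : k ≤ i
  k≤i = +-cancelˡ-≤ i _ _ (s≤s⁻¹ n≤1+i+i)

-- C(n, i) − C(n, i+1) is nondecreasing in n as long as n ≤ 2i.
C-gap-mono : ∀ {m n} i → m ≤ n → n ≤ i + i → n C suc i + m C i ≤ n C i + m C suc i
C-gap-mono {m} i m≤n = go i (≤⇒≤′ m≤n)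
  where
  open ≤-Reasoning
  go : ∀ {n} i → m ≤′ n → n ≤ i + i → n C suc i + m C i ≤ n C i + m C suc i
  go i ≤′-refl _ = ≤-reflexive (+-comm (m C suc i) (m C i))
  go {suc n} (suc j) (≤′-step m≤′n) n<i+i = begin
    suc n C suc (suc j) + m C suc j
      ≡⟨ cong (_+ m C suc j) (nCk+nC[k+1]≡[n+1]C[k+1] n (suc j)) ⟨
    (n C suc j + n C suc (suc j)) + m C suc j
      ≡⟨ +-rotate (n C suc j) _ _ ⟩
    (n C suc (suc j) + m C suc j) + n C suc j
      -- By Pascal's rule the gap at `i = j + 1` grows by C(n, j) - C(n, j+1) when `n` becomes
      -- `n + 1`; this is nonnegative because `n + 1 ≤ 2i`.
      ≤⟨ +-mono-≤ (go (suc j) m≤′n (≤-trans (n≤1+n n) n<i+i))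
                  (C-decreasing n j (≤-trans (s≤s⁻¹ n<i+i) (≤-reflexive (+-suc j j)))) ⟩
    (n C suc j + m C suc (suc j)) + n C j
      ≡⟨ +-rotate (n C j) _ _ ⟨
    (n C j + n C suc j) + m C suc (suc j)
      ≡⟨ cong (_+ m C suc (suc j)) (nCk+nC[k+1]≡[n+1]C[k+1] n j) ⟩
    suc n C suc j + m C suc (suc j) ∎

-- What the smallest case `n = i + 2` of `C-gap-large` comes down to, with `i = 3 + t`.
5+t≤[4+t]C[2+t] : ∀ t → 5 + t ≤ (4 + t) C (2 + t)
5+t≤[4+t]C[2+t] zero    = ≤ᵇ⇒≤ 5 6 _
5+t≤[4+t]C[2+t] (suc t) = begin
  6 + t                                 ≤⟨ +-monoʳ-≤ 6 (m≤n+m t (3 + t)) ⟩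
  6 + ((3 + t) + t)                     ≡⟨ regroup t ⟩
  (5 + t) + (4 + t)
    ≤⟨ +-mono-≤ (5+t≤[4+t]C[2+t] t) (≤-reflexive (sym ([1+n]Cn≡1+n (3 + t)))) ⟩
  (4 + t) C (2 + t) + (4 + t) C (3 + t) ≡⟨ nCk+nC[k+1]≡[n+1]C[k+1] (4 + t) (2 + t) ⟩
  (5 + t) C (3 + t)                     ∎
  where
  open ≤-Reasoning
  regroup : ∀ t → 6 + ((3 + t) + t) ≡ (5 + t) + (4 + t)
  regroup = solve-∀

-- By `C-gap-mono` it suffices to treat `n = i + 2`. For `i ≤ 1` no `n` fits the bounds, and for
-- `i = 2` only `n = 4` does, where the inequality would read 4 + 3 ≤ 6: this is the source of the
-- exception K₃,₁.
C-gap-large : ∀ {n} i → suc i < n → n ≤ i + i → n ≢ 4 → n C suc i + suc i C i ≤ n C i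
C-gap-large 0 i+1<n n≤i+i _ = contradiction (<-≤-trans i+1<n n≤i+i) λ ()
C-gap-large 1 i+1<n n≤i+i _ = contradiction (<-≤-trans i+1<n n≤i+i) (<-irrefl refl)
C-gap-large 2 i+1<n n≤i+i n≢4 = contradiction (≤-antisym n≤i+i i+1<n) n≢4
C-gap-large {n} i@(suc (suc (suc t))) i+1<n n≤i+i _ = +-cancelʳ-≤ ((5 + t) C i) _ _ (begin
  (n C suc i + suc i C i) + (5 + t) C i       ≡⟨ +-swapʳ (n C suc i) _ _ ⟩
  (n C suc i + (5 + t) C i) + suc i C i       ≤⟨ +-monoˡ-≤ (suc i C i) (C-gap-mono i i+1<n n≤i+i) ⟩
  (n C i + (5 + t) C suc i) + suc i C i       ≡⟨ +-assoc (n C i) _ _ ⟩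
  n C i + ((5 + t) C suc i + suc i C i)       ≤⟨ +-monoʳ-≤ (n C i) base ⟩
  n C i + (5 + t) C i                         ∎)
  where
  open ≤-Reasoning
  base : (5 + t) C suc i + suc i C i ≤ (5 + t) C i
  base = begin
    (5 + t) C (4 + t) + (4 + t) C (3 + t)  ≡⟨ cong (_+ (4 + t) C (3 + t)) ([1+n]Cn≡1+n (4 + t)) ⟩
    (5 + t) + (4 + t) C (3 + t)            ≤⟨ +-monoˡ-≤ _ (5+t≤[4+t]C[2+t] t) ⟩
    (4 + t) C (2 + t) + (4 + t) C (3 + t)  ≡⟨ nCk+nC[k+1]≡[n+1]C[k+1] (4 + t) (2 + t) ⟩
    (5 + t) C (3 + t)                      ∎

-- Dominating sets of a complete multipartite graph.

module _ {k : ℕ} (ns : Vec ℕ k) where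

  private
    G = completeMultipartite ns
    n = sum ns
    D? = dominating? G
    d = count D?

  partSet : Fin k → Subset n
  partSet j = tabulate (λ u → does (part ns u ≟ᶠ j))

  ∈-partSet⁺ : ∀ {j u} → part ns u ≡ j → u ∈ partSet j
  ∈-partSet⁺ {j} {u} eq =
    lookup⇒[]= u (partSet j) (trans (lookup∘tabulate _ u) (dec-true (part ns u ≟ᶠ j) eq))

  ∈-partSet⁻ : ∀ {j u} → u ∈ partSet j → part ns u ≡ j
  ∈-partSet⁻ {j} {u} u∈ with part ns u ≟ᶠ j | trans (sym (lookup∘tabulate _ u)) ([]=⇒lookup u∈)
  ... | yes eq | _ = eq

  dominating-upwardClosed : UpwardClosed (Dominating G)
  dominating-upwardClosed S⊆T dom v =
    Sum.map S⊆T (λ (u , u∈S , adj) → u , S⊆T u∈S , adj) (dom v)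

  -- A vertex outside `S` without a neighbour in `S` has all of `S` in its own part.
  dominates-or-in-part : ∀ S → Dominating G S ⊎ ∃ λ v → v ∉ S × S ⊆ partSet (part ns v)
  dominates-or-in-part S with any? (λ v → ¬? (v ∈? S) ×-dec (S ⊆? partSet (part ns v)))
  ... | yes bad = inj₂ bad
  ... | no ¬bad = inj₁ dom
    where
    dom : Dominating G S
    dom v with v ∈? S | any? (λ u → (u ∈? S) ×-dec ¬? (part ns v ≟ᶠ part ns u))
    ... | yes v∈S | _       = inj₁ v∈S
    ... | no _    | yes nbr = inj₂ nbr
    ... | no v∉S  | no ¬nbr = contradiction (v , v∉S , λ {u} u∈S → ∈-partSet⁺
      (sym (decidable-stable (part ns v ≟ᶠ part ns u) λ neq → ¬nbr (u , u∈S , neq)))) ¬bad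

  -- Otherwise `S` would lie in the part of some vertex that it misses, and so be strictly smaller
  -- than that part.
  dominating-of-large : ∀ S → (∀ j → ∣ partSet j ∣ ≤ ∣ S ∣) → Dominating G S
  dominating-of-large S large with dominates-or-in-part S
  ... | inj₁ dom               = dom
  ... | inj₂ (v , v∉S , S⊆part) =
    contradiction (p⊂q⇒∣p∣<∣q∣ (S⊆part , v , ∈-partSet⁺ refl , v∉S)) (≤⇒≯ (large _))

  -- Vertices of one part are pairwise nonadjacent, so a dominating set inside a part must be the
  -- whole part.
  ¬dominating-of-⊆ : ∀ {j S} → ∣ S ∣ < ∣ partSet j ∣ → Dominating G S → ¬ S ⊆ partSet j
  ¬dominating-of-⊆ {j} {S} small dom S⊆part = <⇒≱ small (p⊆q⇒∣p∣≤∣q∣ part⊆S)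
    where
    part⊆S : partSet j ⊆ S
    part⊆S {v} v∈part with dom v
    ... | inj₁ v∈S             = v∈S
    ... | inj₂ (u , u∈S , neq) =
      contradiction (trans (∈-partSet⁻ v∈part) (sym (∈-partSet⁻ (S⊆part u∈S)))) neq

  -- A set that fails to dominate lies in one part; were that not part `j`, it would be disjoint
  -- from `partSet j` and the two sizes would add up to at most `n`.
  dominating-or-⊆ : ∀ j S → n < ∣ S ∣ + ∣ partSet j ∣ → Dominating G S ⊎ S ⊆ partSet j
  dominating-or-⊆ j S big with dominates-or-in-part S
  ... | inj₁ dom            = inj₁ dom
  ... | inj₂ (v , _ , S⊆part) with part ns v ≟ᶠ j
  ...   | yes refl = inj₂ S⊆part
  ...   | no  neq  = contradiction big (≤⇒≯ (begin
    ∣ S ∣ + ∣ partSet j ∣                ≤⟨ +-monoˡ-≤ ∣ partSet j ∣ (p⊆q⇒∣p∣≤∣q∣ S⊆∁) ⟩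
    ∣ ∁ (partSet j) ∣ + ∣ partSet j ∣    ≡⟨ cong (_+ ∣ partSet j ∣) (∣∁p∣≡n∸∣p∣ (partSet j)) ⟩
    n ∸ ∣ partSet j ∣ + ∣ partSet j ∣    ≡⟨ m∸n+n≡m (∣p∣≤n (partSet j)) ⟩
    n                                    ∎))
    where
    open ≤-Reasoning
    S⊆∁ : S ⊆ ∁ (partSet j)
    S⊆∁ u∈S = x∉p⇒x∈∁p λ u∈j → neq (trans (sym (∈-partSet⁻ (S⊆part u∈S))) (∈-partSet⁻ u∈j))

  -- Estimates for the coefficients of the domination polynomial.

  d-all : ∀ i → (∀ j → ∣ partSet j ∣ ≤ i) → n C i ≤ d i
  d-all i small = C≤count D? i λ { S refl → dominating-of-large S small }

  -- With `d-lower` this is dᵢ = C(n, i) - C(m, i) for `m` the size of part `j`, written additively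
  -- to avoid truncated subtraction.
  d-upper : ∀ i j → i < ∣ partSet j ∣ → d i + ∣ partSet j ∣ C i ≤ n C i
  d-upper i j i<m = begin
    d i + ∣ partSet j ∣ C i             ≡⟨ cong (d i +_) (count-⊆ (partSet j) i) ⟨
    d i + count (_⊆? partSet j) i
      ≤⟨ count-disjoint D? (_⊆? partSet j) i (λ { S refl → ¬dominating-of-⊆ i<m }) ⟩
    n C i                               ∎
    where open ≤-Reasoning

  d-lower : ∀ i j → n < i + ∣ partSet j ∣ → n C i ≤ d i + ∣ partSet j ∣ C i
  d-lower i j big = begin
    n C i
      ≤⟨ count-cover D? (_⊆? partSet j) i (λ { S refl → dominating-or-⊆ j S big }) ⟩
    d i + count (_⊆? partSet j) i       ≡⟨ cong (d i +_) (count-⊆ (partSet j) i) ⟩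
    d i + ∣ partSet j ∣ C i             ∎
    where open ≤-Reasoning

  d-increasing : ∀ i → i + i < n → d i ≤ d (suc i)
  d-increasing = count-increasing D? dominating-upwardClosed

  d-decreasing-small-parts : ∀ i → n ≤ i + i → (∀ j → ∣ partSet j ∣ ≤ i) → d (suc i) ≤ d i
  d-decreasing-small-parts i n≤i+i small = begin
    d (suc i)  ≤⟨ count≤C D? (suc i) ⟩
    n C suc i  ≤⟨ C-decreasing n i (m≤n⇒m≤1+n n≤i+i) ⟩
    n C i      ≤⟨ d-all i small ⟩
    d i        ∎
    where open ≤-Reasoning

  -- If `i + 1 < m`, both coefficients are bounded through C(n, ·) - C(m, ·) and `C-gap-mono`
  -- compares them. If `i + 1 = m`, the part itself dominates, so only the bound C(n, i+1) is left
  -- for the next coefficient, and the stronger `C-gap-large` is needed.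
  d-decreasing-large-part : ∀ i j → n ≤ i + i → i < ∣ partSet j ∣ → ∣ partSet j ∣ < n →
    ¬ (n ≡ 4 × ∣ partSet j ∣ ≡ 3) → d (suc i) ≤ d i
  d-decreasing-large-part i j n≤i+i i<m m<n ¬[4,3] = +-cancelʳ-≤ (m C i) _ _ (begin
    d (suc i) + m C i  ≤⟨ bound (m≤n⇒m<n∨m≡n i<m) ⟩
    n C i              ≤⟨ d-lower i j (≤-<-trans n≤i+i (+-monoʳ-< i i<m)) ⟩
    d i + m C i        ∎)
    where
    open ≤-Reasoning
    m = ∣ partSet j ∣
    bound : suc i < m ⊎ suc i ≡ m → d (suc i) + m C i ≤ n C i
    bound (inj₁ 1+i<m) = +-cancelʳ-≤ (m C suc i) _ _ (begin
      (d (suc i) + m C i) + m C suc i  ≡⟨ +-swapʳ (d (suc i)) _ _ ⟩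
      (d (suc i) + m C suc i) + m C i  ≤⟨ +-monoˡ-≤ (m C i) (d-upper (suc i) j 1+i<m) ⟩
      n C suc i + m C i                ≤⟨ C-gap-mono i (<⇒≤ m<n) n≤i+i ⟩
      n C i + m C suc i                ∎)
    bound (inj₂ 1+i≡m) = begin
      d (suc i) + m C i      ≡⟨ cong (λ m → d (suc i) + m C i) 1+i≡m ⟨
      d (suc i) + suc i C i  ≤⟨ +-monoˡ-≤ (suc i C i) (count≤C D? (suc i)) ⟩
      n C suc i + suc i C i  ≤⟨ C-gap-large i (subst (_< n) (sym 1+i≡m) m<n) n≤i+i n≢4 ⟩
      n C i                  ∎
      where
      n≢4 : n ≢ 4
      -- If `n = 4`, then `n ≤ 2i` forces `i ≥ 2`, so `m = i + 1 ≥ 3`, while `m < 4`; this is the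
      -- excluded pair.
      n≢4 n≡4 = ¬[4,3] (n≡4 , ≤-antisym (s≤s⁻¹ (subst (m <_) n≡4 m<n)) (subst (3 ≤_) 1+i≡m (s≤s 2≤i)))
        where
        2≤i : 2 ≤ i
        2≤i = ≮⇒≥ λ i<2 → contradiction
          (≤-trans (subst (_≤ i + i) n≡4 n≤i+i) (+-mono-≤ (s≤s⁻¹ i<2) (s≤s⁻¹ i<2)))
          λ { (s≤s (s≤s ())) }

  -- Location of the mode.

  -- Indices are natural numbers here, so that casts between `Fin` and `ℕ` are confined to
  -- `unimodalAt⇒unimodal`.
  UnimodalAt : ℕ → Set
  UnimodalAt m = m ≤ n × (∀ i → i < n → i < m → d i ≤ d (suc i))
                       × (∀ i → i < n → m ≤ i → d (suc i) ≤ d i)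

  unimodalAt⇒unimodal : ∃ UnimodalAt → Unimodal (dominationPolynomial G)
  unimodalAt⇒unimodal (m , m≤n , inc , dec) = fromℕ< (s≤s m≤n) ,
    (λ i i<k → subst₂ _≤_ (sym (coeff (inject₁ i) (toℕ-inject₁ i))) (sym (coeff (Fin.suc i) refl))
       (inc (toℕ i) (toℕ<n i) (subst (toℕ i <_) (toℕ-fromℕ< (s≤s m≤n)) i<k))) ,
    (λ i k≤i → subst₂ _≤_ (sym (coeff (Fin.suc i) refl)) (sym (coeff (inject₁ i) (toℕ-inject₁ i)))
       (dec (toℕ i) (toℕ<n i) (subst (_≤ toℕ i) (toℕ-fromℕ< (s≤s m≤n)) k≤i)))
    where
    coeff : ∀ (i : Fin (suc n)) {l} → toℕ i ≡ l → dominationPolynomial G i ≡ d l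
    coeff i refl = length-filter-subsets D? (toℕ i)

  -- With `m = n` the bound `d-upper` reads dᵢ + C(n, i) ≤ C(n, i), so every coefficient below index
  -- `n` is 0.
  unimodalAt-single-part : ∀ j → ∣ partSet j ∣ ≡ n → UnimodalAt n
  unimodalAt-single-part j m≡n = ≤-refl ,
    (λ i i<n _ → ≤-trans (+-cancelʳ-≤ (n C i) (d i) 0
      (subst (λ m → d i + m C i ≤ n C i) m≡n (d-upper i j (subst (i <_) (sym m≡n) i<n)))) z≤n) ,
    (λ i i<n n≤i → contradiction i<n (≤⇒≯ n≤i))

  -- K₃,₁ has coefficients 0, 1, 3, 4, 1.
  unimodalAt-K₃,₁ : ∀ j → n ≡ 4 → ∣ partSet j ∣ ≡ 3 → (∀ j → ∣ partSet j ∣ < n) → UnimodalAt 3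
  unimodalAt-K₃,₁ j n≡4 m≡3 proper = subst (3 ≤_) (sym n≡4) (n≤1+n 3) , inc , dec
    where
    open ≤-Reasoning
    small : ∀ j → ∣ partSet j ∣ ≤ 3
    small j = s≤s⁻¹ (subst (∣ partSet j ∣ <_) n≡4 (proper j))
    inc : ∀ i → i < n → i < 3 → d i ≤ d (suc i)
    inc 0 _ _ = d-increasing 0 (subst (0 <_) (sym n≡4) z<s)
    inc 1 _ _ = d-increasing 1 (subst (2 <_) (sym n≡4) (n≤1+n 3))
    inc 2 _ _ = begin
      -- Here C(4, 2) = 6 and C(3, 2) = 3, both found by evaluation, so `d 2 + 3 ≤ 3 + 3`.
      d 2   ≤⟨ +-cancelʳ-≤ 3 (d 2) 3 (subst₂ (λ m n → d 2 + m C 2 ≤ n C 2) m≡3 n≡4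
                 (d-upper 2 j (subst (2 <_) (sym m≡3) ≤-refl))) ⟩
      3     ≤⟨ n≤1+n 3 ⟩
      4 C 3 ≡⟨ cong (_C 3) n≡4 ⟨
      n C 3 ≤⟨ d-all 3 small ⟩
      d 3   ∎
    inc (suc (suc (suc _))) _ (s≤s (s≤s (s≤s ())))
    dec : ∀ i → i < n → 3 ≤ i → d (suc i) ≤ d i
    dec i i<n 3≤i = d-decreasing-small-parts i
      (≤-trans (≤-trans (≤-reflexive n≡4) (m≤m+n 4 2)) (+-mono-≤ 3≤i 3≤i))
      (λ j → ≤-trans (small j) 3≤i)

  -- The threshold is exact: `i < ⌈ n /2⌉` holds precisely when `2i < n`. From there on, the descent
  -- depends on whether some part has more than `i` vertices.
  unimodalAt-half : (∀ j → ∣ partSet j ∣ < n) → (∀ j → ¬ (n ≡ 4 × ∣ partSet j ∣ ≡ 3)) →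
    UnimodalAt ⌈ n /2⌉
  unimodalAt-half proper ¬[4,3] = ⌈n/2⌉≤n n , inc , dec
    where
    open ≤-Reasoning
    inc : ∀ i → i < n → i < ⌈ n /2⌉ → d i ≤ d (suc i)
    inc i _ i<half = d-increasing i (≰⇒> λ n≤i+i → <⇒≱ i<half
      (subst (⌈ n /2⌉ ≤_) (sym (n≡⌈n+n/2⌉ i)) (⌈n/2⌉-mono n≤i+i)))
    dec : ∀ i → i < n → ⌈ n /2⌉ ≤ i → d (suc i) ≤ d i
    dec i i<n half≤i = case any? (λ j → i <? ∣ partSet j ∣) of λ where
        (yes (j , i<m)) → d-decreasing-large-part i j n≤i+i i<m (proper j) (¬[4,3] j)
        (no ¬large)     → d-decreasing-small-parts i n≤i+i (λ j → ≮⇒≥ λ i<m → ¬large (j , i<m))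
      where
      n≤i+i : n ≤ i + i
      n≤i+i = subst (_≤ i + i) (⌊n/2⌋+⌈n/2⌉≡n n)
        (+-mono-≤ (≤-trans (⌊n/2⌋≤⌈n/2⌉ n) half≤i) half≤i)

  unimodalAt-some : ∃ UnimodalAt
  unimodalAt-some with any? (λ j → ∣ partSet j ∣ ≟ n)
  ... | yes (j , m≡n) = n , unimodalAt-single-part j m≡n
  ... | no ¬single with any? (λ j → (n ≟ 4) ×-dec (∣ partSet j ∣ ≟ 3))
  ...   | yes (j , n≡4 , m≡3) = 3 , unimodalAt-K₃,₁ j n≡4 m≡3
            λ j → ≤∧≢⇒< (∣p∣≤n (partSet j)) λ m≡n → ¬single (j , m≡n)
  ...   | no ¬[4,3] = ⌈ n /2⌉ , unimodalAt-half
            (λ j → ≤∧≢⇒< (∣p∣≤n (partSet j)) λ m≡n → ¬single (j , m≡n))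
            (λ j eqs → ¬[4,3] (j , eqs))

theorem2p5 : (k : ℕ) → 1 ≤ k → (ns : Vec ℕ k) → All (λ n → 1 ≤ n) ns →
    Unimodal (dominationPolynomial (completeMultipartite ns))
theorem2p5 k _ ns _ = unimodalAt⇒unimodal ns (unimodalAt-some ns)
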